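{- A ceer $E$ is light if and only if there is a non-trivial quotient $R$ of $E$ which is universal.
   Context: A ceer is a computably enumerable equivalence relation on $\omega$. For equivalence relations $E,R$ on $\omega$, $E\leq R$ means there is a computable $f$ with $x\mathrel{E}y\iff f(x)\mathrel{R}f(y)$ for all $x,y$. A ceer is universal if every ceer is $\leq$ it. $\mathrm{Id}$ is equality on $\omega$; a ceer $E$ is light if $\mathrm{Id}\leq E$. For a ceer $E$ and a c.e. set $W\subseteq\omega^2$, $E_{/W}$ denotes the equivalence relation generated by $E\cup W$; such ceers are called quotients of $E$, and a quotient $R$ of $E$ is non-trivial if $R\neq E$. -}

module Defs where

open import Level using (0ℓ)
open import Data.Nat using (ℕ; zero; suc)
open import Data.Fin using (Fin)
open import Data.Vec using (Vec; []; _∷_; lookup)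
open import Data.Maybe using (Maybe; just; nothing; _>>=_)
open import Data.Product using (Σ; ∃; _×_)
open import Relation.Nullary using (¬_)
open import Relation.Binary.Core using (Rel)
open import Relation.Binary.Structures using (IsEquivalence)
open import Relation.Binary.PropositionalEquality using (_≡_)
open import Relation.Binary.Construct.Union using (_∪_)
open import Relation.Binary.Construct.Closure.Equivalence using (EqClosure)
open import Function.Bundles using (_⇔_)

data Code : ℕ → Set where
  zer  : ∀ {n} → Code n
  succ : Code 1
  proj : ∀ {n} → Fin n → Code n
  comp : ∀ {n m} → Code m → Vec (Code n) m → Code n
  prec : ∀ {n} → Code n → Code (suc (suc n)) → Code (suc n)
  mu   : ∀ {n} → Code (suc n) → Code n

-- Step-indexed evaluation: `eval k c xs ≡ just v` means the computation
-- of c on xs halts with value v within fuel k.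
mutual
  eval : ∀ {n} → ℕ → Code n → Vec ℕ n → Maybe ℕ
  eval zero    _          _        = nothing
  eval (suc k) zer        xs       = just 0
  eval (suc k) succ       (x ∷ []) = just (suc x)
  eval (suc k) (proj i)   xs       = just (lookup xs i)
  eval (suc k) (comp f gs) xs      = evalAll k gs xs >>= eval k f
  eval (suc k) (prec g h) (y ∷ xs) = evalRec k g h y xs
  eval (suc k) (mu f)     xs       = search k f xs 0

  evalAll : ∀ {n m} → ℕ → Vec (Code n) m → Vec ℕ n → Maybe (Vec ℕ m)
  evalAll k []       xs = just []
  evalAll k (g ∷ gs) xs =
    eval k g xs >>= λ v → evalAll k gs xs >>= λ vs → just (v ∷ vs)

  evalRec : ∀ {n} → ℕ → Code n → Code (suc (suc n)) → ℕ → Vec ℕ n → Maybe ℕ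
  evalRec k g h zero    xs = eval k g xs
  evalRec k g h (suc y) xs = evalRec k g h y xs >>= λ r → eval k h (y ∷ r ∷ xs)

  search : ∀ {n} → ℕ → Code (suc n) → Vec ℕ n → ℕ → Maybe ℕ
  search zero    f xs y = nothing
  search (suc j) f xs y = eval j f (y ∷ xs) >>= λ where
    zero    → just y
    (suc _) → search j f xs (suc y)

Halts : ∀ {n} → Code n → Vec ℕ n → Set
Halts c xs = ∃ λ k → ∃ λ v → eval k c xs ≡ just v

Computable : (ℕ → ℕ) → Set
Computable f = Σ (Code 1) λ c → ∀ x → ∃ λ k → eval k c (x ∷ []) ≡ just (f x)

IsCE₂ : Rel ℕ 0ℓ → Set
IsCE₂ W = Σ (Code 2) λ c → ∀ x y → W x y ⇔ Halts c (x ∷ y ∷ [])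

IsCeer : Rel ℕ 0ℓ → Set
IsCeer E = IsEquivalence E × IsCE₂ E

_≤c_ : Rel ℕ 0ℓ → Rel ℕ 0ℓ → Set
E ≤c R = ∃ λ (f : ℕ → ℕ) → Computable f × (∀ x y → E x y ⇔ R (f x) (f y))

Universal : Rel ℕ 0ℓ → Set₁
Universal R = ∀ (E : Rel ℕ 0ℓ) → IsCeer E → E ≤c R

Light : Rel ℕ 0ℓ → Set
Light E = _≡_ ≤c E

Quot : Rel ℕ 0ℓ → Rel ℕ 0ℓ → Rel ℕ 0ℓ
Quot E W = EqClosure (E ∪ W)

_≠R_ : Rel ℕ 0ℓ → Rel ℕ 0ℓ → Set
R ≠R E = ¬ (∀ x y → R x y ⇔ E x y)

{-# OPTIONS --safe #-}

-- If f reduces Id to E, glue f⟨c,x⟩ to f⟨c,y⟩ whenever the code c halts on (x,y).  Since distinct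
-- f-images are E-inequivalent, a chain of glueings starting in the column {f⟨c,x⟩ : x ∈ ω} stays
-- in it, up to E, so if c enumerates a ceer A then x ↦ f⟨c,x⟩ reduces A to the quotient.  The
-- glueing is c.e. because halting is generated by finitely many Horn clauses over Gödel numbers: a
-- derivation, read from its axioms to its goal, is a list of clause instances acting on a stack of
-- derived goals, and checking such a list needs only pairing and arithmetic.
-- Conversely a reduction of Id to any quotient of E is already a reduction of Id to E.

module Submission where

open import Defs
open import Level using (0ℓ)
open import Data.Nat using (ℕ; zero; suc; pred; _+_; _*_; _∸_; _⊔_; _≤_; _<_; z≤n; s≤s)
open import Data.Nat.Properties
open import Data.Fin using (Fin; zero; suc; toℕ)
open import Data.Vec using (Vec; []; _∷_; lookup)
open import Data.Maybe using (Maybe; just; _>>=_)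
open import Data.Maybe.Properties using (just-injective)
open import Data.List using (List; []; _∷_; foldr)
open import Data.List.Membership.Propositional using (_∈_)
open import Data.List.Relation.Unary.All as All using (All; []; _∷_)
open import Data.List.Relation.Unary.Any using (here; there)
open import Data.Unit using (⊤)
open import Data.Product using (Σ; ∃; ∃₂; _×_; _,_; proj₁; proj₂)
open import Data.Sum using (inj₁; inj₂)
open import Function.Base using (_∘_)
open import Function.Bundles using (_⇔_; mk⇔; module Equivalence)
open import Relation.Binary.Core using (Rel)
open import Relation.Binary.Structures using (IsEquivalence)
open import Relation.Binary.PropositionalEquality
open import Relation.Binary.Construct.Union using (_∪_)
open import Relation.Binary.Construct.Closure.Symmetric using (fwd; bwd)
open import Relation.Binary.Construct.Closure.ReflexiveTransitive using (ε; _◅_)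
open import Relation.Binary.Construct.Closure.Equivalence as EqC using (EqClosure)

open Equivalence using (to; from)

private variable
  n m : ℕ

-- Big-step semantics

mutual
  -- Evaluation without fuel: its rules have premises and a conclusion, the shape that Horn clauses
  -- can imitate.
  data _[_]⇓_ : Code n → Vec ℕ n → ℕ → Set where
    zer   : {xs : Vec ℕ n} → zer [ xs ]⇓ 0
    succ  : ∀ {x} → succ [ x ∷ [] ]⇓ suc x
    proj  : ∀ {i} {xs : Vec ℕ n} → proj i [ xs ]⇓ lookup xs i
    comp  : ∀ {f : Code m} {gs} {xs : Vec ℕ n} {vs v} →
            gs [ xs ]⇓* vs → f [ vs ]⇓ v → comp f gs [ xs ]⇓ v
    precz : ∀ {g h} {xs : Vec ℕ n} {v} →
            g [ xs ]⇓ v → prec g h [ 0 ∷ xs ]⇓ v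
    precs : ∀ {g h} {xs : Vec ℕ n} {y r v} →
            prec g h [ y ∷ xs ]⇓ r → h [ y ∷ r ∷ xs ]⇓ v →
            prec g h [ suc y ∷ xs ]⇓ v
    mu    : ∀ {f} {xs : Vec ℕ n} {v} → Search f xs 0 v → mu f [ xs ]⇓ v

  data _[_]⇓*_ : Vec (Code n) m → Vec ℕ n → Vec ℕ m → Set where
    []  : {xs : Vec ℕ n} → [] [ xs ]⇓* []
    _∷_ : ∀ {g} {gs : Vec (Code n) m} {xs v vs} →
          g [ xs ]⇓ v → gs [ xs ]⇓* vs → (g ∷ gs) [ xs ]⇓* (v ∷ vs)

  data Search (f : Code (suc n)) (xs : Vec ℕ n) : ℕ → ℕ → Set where
    stop : ∀ {y} → f [ y ∷ xs ]⇓ 0 → Search f xs y y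
    next : ∀ {y w v} → f [ y ∷ xs ]⇓ suc w → Search f xs (suc y) v → Search f xs y v

module _ {A B : Set} {f : A → Maybe B} {v : B} where

  bind⁻ : (a : Maybe A) → (a >>= f) ≡ just v → ∃ λ u → a ≡ just u × f u ≡ just v
  bind⁻ (just u) eq = u , refl , eq

  bind⁺ : ∀ {a u} → a ≡ just u → f u ≡ just v → (a >>= f) ≡ just v
  bind⁺ refl eq = eq

mutual
  eval⇒⇓ : ∀ k (c : Code n) {xs v} → eval k c xs ≡ just v → c [ xs ]⇓ v
  eval⇒⇓ (suc k) zer refl = zer
  eval⇒⇓ (suc k) succ {x ∷ []} refl = succ
  eval⇒⇓ (suc k) (proj i) refl = proj
  eval⇒⇓ (suc k) (comp f gs) {xs} eq with bind⁻ (evalAll k gs xs) eq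
  ... | vs , p , q = comp (evalAll⇒⇓* k gs p) (eval⇒⇓ k f q)
  eval⇒⇓ (suc k) (prec g h) {y ∷ xs} eq = evalRec⇒⇓ k g h y eq
  eval⇒⇓ (suc k) (mu f) eq = mu (search⇒Search k f 0 eq)

  evalAll⇒⇓* : ∀ k (gs : Vec (Code n) m) {xs vs} → evalAll k gs xs ≡ just vs → gs [ xs ]⇓* vs
  evalAll⇒⇓* k [] refl = []
  evalAll⇒⇓* k (g ∷ gs) {xs} eq with bind⁻ (eval k g xs) eq
  ... | v , p , q with bind⁻ (evalAll k gs xs) q
  ... | vs , q′ , refl = eval⇒⇓ k g p ∷ evalAll⇒⇓* k gs q′

  evalRec⇒⇓ : ∀ k (g : Code n) h y {xs v} →
              evalRec k g h y xs ≡ just v → prec g h [ y ∷ xs ]⇓ v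
  evalRec⇒⇓ k g h zero eq = precz (eval⇒⇓ k g eq)
  evalRec⇒⇓ k g h (suc y) {xs} eq with bind⁻ (evalRec k g h y xs) eq
  ... | r , p , q = precs (evalRec⇒⇓ k g h y p) (eval⇒⇓ k h q)

  search⇒Search : ∀ k (f : Code (suc n)) y {xs v} → search k f xs y ≡ just v → Search f xs y v
  search⇒Search (suc k) f y {xs} eq with bind⁻ (eval k f (y ∷ xs)) eq
  ... | zero  , p , refl = stop (eval⇒⇓ k f p)
  ... | suc w , p , q    = next (eval⇒⇓ k f p) (search⇒Search k f (suc y) q)

mutual
  -- Lets subcomputations that halted with different fuels be repeated at the maximum of the two.
  eval-mono : ∀ {k l} → k ≤ l → (c : Code n) → ∀ {xs v} →
              eval k c xs ≡ just v → eval l c xs ≡ just v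
  eval-mono (s≤s k≤l) zer eq = eq
  eval-mono (s≤s k≤l) succ {x ∷ []} eq = eq
  eval-mono (s≤s k≤l) (proj i) eq = eq
  eval-mono {k = suc k} (s≤s k≤l) (comp f gs) {xs} eq with bind⁻ (evalAll k gs xs) eq
  ... | vs , p , q = bind⁺ (evalAll-mono k≤l gs p) (eval-mono k≤l f q)
  eval-mono (s≤s k≤l) (prec g h) {y ∷ xs} eq = evalRec-mono k≤l g h y eq
  eval-mono (s≤s k≤l) (mu f) eq = search-mono k≤l f 0 eq

  evalAll-mono : ∀ {k l} → k ≤ l → (gs : Vec (Code n) m) → ∀ {xs vs} →
                 evalAll k gs xs ≡ just vs → evalAll l gs xs ≡ just vs
  evalAll-mono k≤l [] eq = eq
  evalAll-mono {k = k} k≤l (g ∷ gs) {xs} eq with bind⁻ (eval k g xs) eq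
  ... | v , p , q with bind⁻ (evalAll k gs xs) q
  ... | vs , q′ , refl = bind⁺ (eval-mono k≤l g p) (bind⁺ (evalAll-mono k≤l gs q′) refl)

  evalRec-mono : ∀ {k l} → k ≤ l → (g : Code n) → ∀ h y {xs v} →
                 evalRec k g h y xs ≡ just v → evalRec l g h y xs ≡ just v
  evalRec-mono k≤l g h zero eq = eval-mono k≤l g eq
  evalRec-mono {k = k} k≤l g h (suc y) {xs} eq with bind⁻ (evalRec k g h y xs) eq
  ... | r , p , q = bind⁺ (evalRec-mono k≤l g h y p) (eval-mono k≤l h q)

  search-mono : ∀ {k l} → k ≤ l → (f : Code (suc n)) → ∀ y {xs v} →
                search k f xs y ≡ just v → search l f xs y ≡ just v
  search-mono {k = suc k} (s≤s k≤l) f y {xs} eq with bind⁻ (eval k f (y ∷ xs)) eq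
  ... | zero  , p , q = bind⁺ (eval-mono k≤l f p) q
  ... | suc w , p , q = bind⁺ (eval-mono k≤l f p) (search-mono k≤l f (suc y) q)

mutual
  ⇓⇒eval : {c : Code n} → ∀ {xs v} → c [ xs ]⇓ v → ∃ λ k → eval k c xs ≡ just v
  ⇓⇒eval zer  = 1 , refl
  ⇓⇒eval succ = 1 , refl
  ⇓⇒eval proj = 1 , refl
  ⇓⇒eval (comp {f = f} {gs} ds d) with ⇓*⇒evalAll ds | ⇓⇒eval d
  ... | k , p | l , q = suc (k ⊔ l) ,
    bind⁺ (evalAll-mono (m≤m⊔n k l) gs p) (eval-mono (m≤n⊔m k l) f q)
  ⇓⇒eval (precz d) with ⇓⇒eval d
  ... | k , p = suc k , p
  ⇓⇒eval (precs {g = g} {h} {y = y} d e) with ⇓⇒eval d | ⇓⇒eval e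
  -- Fuel 0 yields `nothing`, so the fuel is a successor and `p` is already a statement about
  -- `evalRec k`.
  ... | suc k , p | l , q = suc (k ⊔ l) ,
    bind⁺ (evalRec-mono (m≤m⊔n k l) g h y p) (eval-mono (m≤n⊔m k l) h q)
  ⇓⇒eval (mu s) with Search⇒search s
  ... | k , p = suc k , p

  ⇓*⇒evalAll : {gs : Vec (Code n) m} → ∀ {xs vs} →
               gs [ xs ]⇓* vs → ∃ λ k → evalAll k gs xs ≡ just vs
  ⇓*⇒evalAll [] = 0 , refl
  ⇓*⇒evalAll (_∷_ {g = g} {gs} d ds) with ⇓⇒eval d | ⇓*⇒evalAll ds
  ... | k , p | l , q = k ⊔ l ,
    bind⁺ (eval-mono (m≤m⊔n k l) g p) (bind⁺ (evalAll-mono (m≤n⊔m k l) gs q) refl)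

  Search⇒search : {f : Code (suc n)} → ∀ {xs y v} →
                  Search f xs y v → ∃ λ k → search k f xs y ≡ just v
  Search⇒search (stop d) with ⇓⇒eval d
  ... | k , p = suc k , bind⁺ p refl
  Search⇒search {f = f} (next {y = y} d s) with ⇓⇒eval d | Search⇒search s
  ... | k , p | l , q = suc (k ⊔ l) ,
    bind⁺ (eval-mono (m≤m⊔n k l) f p) (search-mono (m≤n⊔m k l) f (suc y) q)

-- At a common fuel both derivations describe the value of the single function `eval`.
⇓-deterministic : {c : Code n} → ∀ {xs v w} → c [ xs ]⇓ v → c [ xs ]⇓ w → v ≡ w
⇓-deterministic {c = c} d e with ⇓⇒eval d | ⇓⇒eval e
... | k , p | l , q = just-injective
  (trans (sym (eval-mono (m≤m⊔n k l) c p)) (eval-mono (m≤n⊔m k l) c q))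

-- Total computable functions

-- The function is an index and the code a field, so that combinators assemble the code by following
-- the expression that defines the function.
record Comp {n} (F : Vec ℕ n → ℕ) : Set where
  field
    code    : Code n
    correct : ∀ xs → code [ xs ]⇓ F xs

open Comp

private variable
  e f g h : Vec ℕ n → ℕ

Comp₁ : (ℕ → ℕ) → Set
Comp₁ F = Comp {1} λ xs → F (lookup xs zero)

Comp₂ : (ℕ → ℕ → ℕ) → Set
Comp₂ F = Comp {2} λ xs → F (lookup xs zero) (lookup xs (suc zero))

Comp₃ : (ℕ → ℕ → ℕ → ℕ) → Set
Comp₃ F = Comp {3} λ xs → F (lookup xs zero) (lookup xs (suc zero)) (lookup xs (suc (suc zero)))

varᶜ : (i : Fin n) → Comp (λ xs → lookup xs i)
varᶜ i .code      = proj i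
varᶜ i .correct _ = proj

app₁ : ∀ F → Comp₁ F → Comp f → Comp (λ xs → F (f xs))
app₁ F F-comp f .code       = comp (F-comp .code) (f .code ∷ [])
app₁ F F-comp f .correct xs = comp (f .correct xs ∷ []) (F-comp .correct _)

app₂ : ∀ F → Comp₂ F → Comp f → Comp g → Comp (λ xs → F (f xs) (g xs))
app₂ F F-comp f g .code       = comp (F-comp .code) (f .code ∷ g .code ∷ [])
app₂ F F-comp f g .correct xs = comp (f .correct xs ∷ g .correct xs ∷ []) (F-comp .correct _)

app₃ : ∀ F → Comp₃ F → Comp f → Comp g → Comp h → Comp (λ xs → F (f xs) (g xs) (h xs))
app₃ F F-comp f g h .code       = comp (F-comp .code) (f .code ∷ g .code ∷ h .code ∷ [])
app₃ F F-comp f g h .correct xs =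
  comp (f .correct xs ∷ g .correct xs ∷ h .correct xs ∷ []) (F-comp .correct _)

-- Asks for the recursion equations of `F`, so that functions defined by pattern matching qualify,
-- mostly by `refl`.
recᶜ : {F : Vec ℕ (suc n) → ℕ} → Comp g → Comp h →
       (∀ xs → F (0 ∷ xs) ≡ g xs) →
       (∀ y xs → F (suc y ∷ xs) ≡ h (y ∷ F (y ∷ xs) ∷ xs)) → Comp F
recᶜ g h F-zero F-suc .code = prec (g .code) (h .code)
recᶜ {F = F} g h F-zero F-suc .correct (y ∷ xs) = go y
  where
  go : ∀ y → prec (g .code) (h .code) [ y ∷ xs ]⇓ F (y ∷ xs)
  go zero    = subst (_ [ _ ]⇓_) (sym (F-zero xs)) (precz (g .correct xs))
  go (suc y) = subst (_ [ _ ]⇓_) (sym (F-suc y xs)) (precs (go y) (h .correct _))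

sucᶜ : Comp f → Comp (λ xs → suc (f xs))
sucᶜ {f = f} = app₁ suc λ where
  .code             → succ
  .correct (x ∷ []) → succ

constᶜ : ∀ k → Comp {n} (λ _ → k)
constᶜ zero .code      = zer
constᶜ zero .correct _ = zer
constᶜ (suc k)         = sucᶜ (constᶜ k)

infixl 6 _+ᶜ_ _∸ᶜ_
infixl 7 _*ᶜ_

_+ᶜ_ : Comp f → Comp g → Comp (λ xs → f xs + g xs)
_+ᶜ_ = app₂ _+_ (recᶜ (varᶜ zero) (sucᶜ (varᶜ (suc zero))) (λ _ → refl) (λ _ _ → refl))

_*ᶜ_ : Comp f → Comp g → Comp (λ xs → f xs * g xs)
_*ᶜ_ = app₂ _*_ (recᶜ (constᶜ 0) (varᶜ (suc (suc zero)) +ᶜ varᶜ (suc zero))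
                  (λ _ → refl) (λ _ _ → refl))

predᶜ : Comp f → Comp (λ xs → pred (f xs))
predᶜ = app₁ pred (recᶜ (constᶜ 0) (varᶜ zero) (λ _ → refl) (λ _ _ → refl))

-- Subtraction iterates `pred` along the subtrahend; as `prec` recurses on its first argument, the
-- arguments are swapped.
_∸ᶜ_ : Comp f → Comp g → Comp (λ xs → f xs ∸ g xs)
f ∸ᶜ g = app₂ (λ y x → x ∸ y)
  (recᶜ (varᶜ zero) (predᶜ (varᶜ (suc zero))) (λ _ → refl)
        (λ y xs → sym (pred[m∸n]≡m∸[1+n] (lookup xs zero) y))) g f

ifz : ℕ → ℕ → ℕ → ℕ
ifz zero    a b = a
ifz (suc _) a b = b

ifzᶜ : Comp f → Comp g → Comp h → Comp (λ xs → ifz (f xs) (g xs) (h xs))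
ifzᶜ = app₃ ifz (recᶜ (varᶜ zero) (varᶜ (suc (suc (suc zero)))) (λ _ → refl) (λ _ _ → refl))

-- Turns equality into vanishing, so that a conjunction of tests becomes a sum and a disjunction a
-- product.
dist : ℕ → ℕ → ℕ
dist a b = (a ∸ b) + (b ∸ a)

dist-refl : ∀ a → dist a a ≡ 0
dist-refl a = cong₂ _+_ (n∸n≡0 a) (n∸n≡0 a)

dist≡0⇒≡ : ∀ {a b} → dist a b ≡ 0 → a ≡ b
dist≡0⇒≡ {a} {b} eq =
  ≤-antisym (m∸n≡0⇒m≤n (m+n≡0⇒m≡0 (a ∸ b) eq)) (m∸n≡0⇒m≤n (m+n≡0⇒n≡0 (a ∸ b) eq))

dist+dist≡0⇒≡×≡ : ∀ {a b c d} → dist a b + dist c d ≡ 0 → a ≡ b × c ≡ d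
dist+dist≡0⇒≡×≡ {a} {b} {c} {d} eq =
  dist≡0⇒≡ (m+n≡0⇒m≡0 (dist a b) eq) , dist≡0⇒≡ (m+n≡0⇒n≡0 (dist a b) eq)

distᶜ : Comp f → Comp g → Comp (λ xs → dist (f xs) (g xs))
distᶜ f g = (f ∸ᶜ g) +ᶜ (g ∸ᶜ f)

Computable⇒Comp₁ : ∀ {F} → Computable F → Comp₁ F
Computable⇒Comp₁ (c , halts) .code             = c
Computable⇒Comp₁ (c , halts) .correct (x ∷ []) = eval⇒⇓ (proj₁ (halts x)) c (proj₂ (halts x))

Comp₁⇒Computable : ∀ {F} → Comp₁ F → Computable F
Comp₁⇒Computable F = F .code , λ x → ⇓⇒eval (F .correct (x ∷ []))

Search-result : {f : Code (suc n)} → ∀ {xs y v} → Search f xs y v → f [ v ∷ xs ]⇓ 0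
Search-result (stop d)   = d
Search-result (next d s) = Search-result s

-- Since `D` is total, unbounded search reaches its first zero whenever there is one. That zero may
-- lie below the given one, but any zero witnesses `W`.
IsCE₂-∃ : ∀ {W} {D : Vec ℕ 3 → ℕ} → Comp D →
          (∀ x y → W x y ⇔ ∃ λ k → D (k ∷ x ∷ y ∷ []) ≡ 0) → IsCE₂ W
IsCE₂-∃ {D = D} D-comp W⇔ = mu (D-comp .code) , λ x y → mk⇔
  (λ w → let k , Dk≡0 = W⇔ x y .to w
             v , s    = find k (subst (λ m → D (m ∷ x ∷ y ∷ []) ≡ 0) (sym (+-identityʳ k)) Dk≡0)
             l , eq   = ⇓⇒eval (mu s)
         in l , v , eq)
  (λ (k , v , eq) → W⇔ x y .from (v , result-zero (eval⇒⇓ k _ eq)))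
  where
  -- The known zero is `k + y`; the induction is on its distance `k` from the current point `y`.
  find : ∀ {xs} k {y} → D (k + y ∷ xs) ≡ 0 → ∃ (Search (D-comp .code) xs y)
  find {xs} k {y} Dk≡0 with D (y ∷ xs) in eq | D-comp .correct (y ∷ xs)
  ... | zero  | d = y , stop d
  find {xs} zero    Dk≡0 | suc _ | d with () ← trans (sym eq) Dk≡0
  find {xs} (suc k) {y} Dk≡0 | suc _ | d
    with v , s ← find k (subst (λ m → D (m ∷ xs) ≡ 0) (sym (+-suc k y)) Dk≡0) = v , next d s

  result-zero : ∀ {xs v} → mu (D-comp .code) [ xs ]⇓ v → D (v ∷ xs) ≡ 0
  result-zero (mu s) = ⇓-deterministic (D-comp .correct _) (Search-result s)

-- Pairing

infixr 5 _∙_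

-- Opacity keeps Gödel numbers symbolic during type checking; the rest of the proof works from the
-- laws and codes provided here.
abstract
  tri : ℕ → ℕ
  tri zero    = 0
  tri (suc w) = suc w + tri w

  -- The Cantor pairing, shifted so that 0 is not a pair.
  _∙_ : ℕ → ℕ → ℕ
  a ∙ b = suc (tri (a + b) + a)

  -- The w with tri w ≤ k < tri (suc w).
  row : ℕ → ℕ
  row zero    = 0
  row (suc k) = ifz (tri (suc (row k)) ∸ suc k) (suc (row k)) (row k)

  hd tl : ℕ → ℕ
  hd k = pred k ∸ tri (row (pred k))
  tl k = row (pred k) ∸ hd k

  -- The row grows only on reaching `tri (suc w)`, which is still `w ∸ a` places off.
  row-suc : ∀ {w a} → row (tri w + a) ≡ w → a < w → row (tri w + suc a) ≡ w
  row-suc {w} {a} eq a<w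
    rewrite +-suc (tri w) a | eq | +-comm w (tri w) | [m+n]∸[m+o]≡n∸o (tri w) w a
    with suc _ ← w ∸ a | _ ← m<n⇒0<n∸m a<w = refl

  row-tri : ∀ w {a} → a ≤ w → row (tri w + a) ≡ w
  row-tri zero    z≤n = refl
  -- The first place of row `suc w` is the successor of the last place, `tri w + w`, of row `w`.
  row-tri (suc w) {zero} _
    rewrite +-identityʳ (w + tri w) | +-comm w (tri w) | row-tri w ≤-refl
          | +-comm (tri w) w | n∸n≡0 (w + tri w) = refl
  row-tri (suc w) {suc a} a<w = row-suc (row-tri (suc w) (<⇒≤ a<w)) a<w

  hd-∙ : ∀ a b → hd (a ∙ b) ≡ a
  hd-∙ a b rewrite row-tri (a + b) (m≤m+n a b) = m+n∸m≡n (tri (a + b)) a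

  tl-∙ : ∀ a b → tl (a ∙ b) ≡ b
  tl-∙ a b rewrite hd-∙ a b | row-tri (a + b) (m≤m+n a b) = m+n∸m≡n a b

  ∙≢0 : ∀ {a b} → a ∙ b ≢ 0
  ∙≢0 ()

  triᶜ : Comp f → Comp (λ xs → tri (f xs))
  triᶜ = app₁ tri (recᶜ (constᶜ 0) (sucᶜ (varᶜ zero) +ᶜ varᶜ (suc zero))
                        (λ _ → refl) (λ _ _ → refl))

  rowᶜ : Comp f → Comp (λ xs → row (f xs))
  rowᶜ = app₁ row (recᶜ (constᶜ 0)
    (ifzᶜ (triᶜ (sucᶜ (varᶜ (suc zero))) ∸ᶜ sucᶜ (varᶜ zero))
          (sucᶜ (varᶜ (suc zero))) (varᶜ (suc zero)))
    (λ _ → refl) (λ _ _ → refl))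

  hdᶜ : Comp f → Comp (λ xs → hd (f xs))
  hdᶜ f = predᶜ f ∸ᶜ triᶜ (rowᶜ (predᶜ f))

  tlᶜ : Comp f → Comp (λ xs → tl (f xs))
  tlᶜ f = rowᶜ (predᶜ f) ∸ᶜ hdᶜ f

  infixr 5 _∙ᶜ_

  _∙ᶜ_ : Comp f → Comp g → Comp (λ xs → f xs ∙ g xs)
  f ∙ᶜ g = sucᶜ (triᶜ (f +ᶜ g) +ᶜ f)

∙-injective : ∀ {a b c d} → a ∙ b ≡ c ∙ d → a ≡ c × b ≡ d
∙-injective {a} {b} {c} {d} eq =
  trans (sym (hd-∙ a b)) (trans (cong hd eq) (hd-∙ c d)) ,
  trans (sym (tl-∙ a b)) (trans (cong tl eq) (tl-∙ c d))

infixl 8 _!_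

_!_ : ℕ → ℕ → ℕ
k ! zero  = hd k
k ! suc i = tl k ! i

!ᶜ : ∀ i → Comp f → Comp (λ xs → f xs ! i)
!ᶜ zero    f = hdᶜ f
!ᶜ (suc i) f = !ᶜ i (tlᶜ f)

nth : List ℕ → ℕ → ℕ
-- The default is what the projections yield on 0, the code of the empty list, so that `⌜⌝ˡ-!` holds
-- at every index.
nth []       i       = 0 ! i
nth (x ∷ xs) zero    = x
nth (x ∷ xs) (suc i) = nth xs i

⌜_⌝ˡ : List ℕ → ℕ
⌜_⌝ˡ = foldr _∙_ 0

⌜⌝ˡ-! : ∀ xs i → ⌜ xs ⌝ˡ ! i ≡ nth xs i
⌜⌝ˡ-! []       i       = refl
⌜⌝ˡ-! (x ∷ xs) zero    = hd-∙ x _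
⌜⌝ˡ-! (x ∷ xs) (suc i) = trans (cong (_! i) (tl-∙ x _)) (⌜⌝ˡ-! xs i)

-- Inductive generation by Horn clauses

infixr 5 _⊙_

data Term : Set where
  var : ℕ → Term
  lit : ℕ → Term
  s   : Term → Term
  _⊙_ : Term → Term → Term

⟦_⟧ : Term → (ℕ → ℕ) → ℕ
⟦ var i ⟧ θ = θ i
⟦ lit k ⟧ θ = k
⟦ s t ⟧   θ = suc (⟦ t ⟧ θ)
⟦ t ⊙ u ⟧ θ = ⟦ t ⟧ θ ∙ ⟦ u ⟧ θ

⟦⟧-cong : ∀ t {θ η} → (∀ i → θ i ≡ η i) → ⟦ t ⟧ θ ≡ ⟦ t ⟧ η
⟦⟧-cong (var i) eq = eq i
⟦⟧-cong (lit k) eq = refl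
⟦⟧-cong (s t)   eq = cong suc (⟦⟧-cong t eq)
⟦⟧-cong (t ⊙ u) eq = cong₂ _∙_ (⟦⟧-cong t eq) (⟦⟧-cong u eq)

⟦⟧ᶜ : ∀ t → Comp f → Comp (λ xs → ⟦ t ⟧ (f xs !_))
⟦⟧ᶜ (var i) f = !ᶜ i f
⟦⟧ᶜ (lit k) f = constᶜ k
⟦⟧ᶜ (s t)   f = sucᶜ (⟦⟧ᶜ t f)
⟦⟧ᶜ (t ⊙ u) f = ⟦⟧ᶜ t f ∙ᶜ ⟦⟧ᶜ u f

infix 4 _⊢_

record Clause : Set where
  constructor _⊢_
  field
    premises   : List Term
    conclusion : Term

open Clause

push : (ℕ → ℕ) → List Term → ℕ → ℕ
push θ []       r = r
push θ (t ∷ ts) r = ⟦ t ⟧ θ ∙ push θ ts r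

push-cong : ∀ ts {θ η r} → (∀ i → θ i ≡ η i) → push θ ts r ≡ push η ts r
push-cong []       eq = refl
push-cong (t ∷ ts) eq = cong₂ _∙_ (⟦⟧-cong t eq) (push-cong ts eq)

pushᶜ : ∀ ts → Comp f → Comp g → Comp (λ xs → push (f xs !_) ts (g xs))
pushᶜ []       f g = g
pushᶜ (t ∷ ts) f g = ⟦⟧ᶜ t f ∙ᶜ pushᶜ ts f g

-- Zero exactly when c, instantiated by θ, derives a from goals on top of the stack k with the stack
-- r below them.
gap : Clause → (θ : ℕ → ℕ) (a r k : ℕ) → ℕ
gap c θ a r k = dist a (⟦ conclusion c ⟧ θ) + dist k (push θ (premises c) r)

-- A product, because one fitting clause is enough; the empty product 1 says that none fits.
mismatch : List Clause → (θ : ℕ → ℕ) (a r k : ℕ) → ℕ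
mismatch []       θ a r k = 1
mismatch (c ∷ cs) θ a r k = gap c θ a r k * mismatch cs θ a r k

mismatch⁻ : ∀ cs {θ a r k} → mismatch cs θ a r k ≡ 0 →
            ∃ λ c → c ∈ cs × a ≡ ⟦ conclusion c ⟧ θ × k ≡ push θ (premises c) r
mismatch⁻ (c ∷ cs) {θ} {a} {r} {k} eq with m*n≡0⇒m≡0∨n≡0 (gap c θ a r k) eq
... | inj₁ p = c , here refl , dist+dist≡0⇒≡×≡ p
... | inj₂ p with d , d∈cs , q ← mismatch⁻ cs p = d , there d∈cs , q

mismatch⁺ : ∀ {c cs θ a r k} → c ∈ cs → a ≡ ⟦ conclusion c ⟧ θ → k ≡ push θ (premises c) r →
            mismatch cs θ a r k ≡ 0
mismatch⁺ {a = a} {k = k} (here refl) refl refl rewrite dist-refl a | dist-refl k = refl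
mismatch⁺ {cs = d ∷ cs} {θ} {a} {r} {k} (there c∈cs) p q =
  trans (cong (gap d θ a r k *_) (mismatch⁺ c∈cs p q)) (*-zeroʳ (gap d θ a r k))

mismatchᶜ : ∀ cs → Comp e → Comp f → Comp g → Comp h →
            Comp (λ xs → mismatch cs (e xs !_) (f xs) (g xs) (h xs))
mismatchᶜ []       e f g h = constᶜ 1
mismatchᶜ (c ∷ cs) e f g h =
  (distᶜ f (⟦⟧ᶜ (conclusion c) e) +ᶜ distᶜ h (pushᶜ (premises c) e g)) *ᶜ mismatchᶜ cs e f g h

module Generation (clauses : List Clause) where

  mutual
    -- The substitution is presented by a number `e`, so that an inference can be recorded inside a
    -- certificate.
    data Der : ℕ → Set where
      der : ∀ {ts t} → (ts ⊢ t) ∈ clauses → ∀ e → Ders (e !_) ts → Der (⟦ t ⟧ (e !_))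

    data Ders (θ : ℕ → ℕ) : List Term → Set where
      []  : Ders θ []
      _∷_ : ∀ {t ts} → Der (⟦ t ⟧ θ) → Ders θ ts → Ders θ (t ∷ ts)

  Ders-cong : ∀ {θ η ts} → (∀ i → θ i ≡ η i) → Ders θ ts → Ders η ts
  Ders-cong eq [] = []
  Ders-cong eq (_∷_ {t} d ds) = subst Der (⟦⟧-cong t eq) d ∷ Ders-cong eq ds

  -- `nth xs` and the projections of `⌜ xs ⌝ˡ` agree only pointwise, hence the transport along the
  -- congruence lemmas.
  derˡ : ∀ {ts t} → (ts ⊢ t) ∈ clauses → ∀ xs → Ders (nth xs) ts → Der (⟦ t ⟧ (nth xs))
  derˡ {t = t} c∈ xs ds =
    subst Der (⟦⟧-cong t (⌜⌝ˡ-! xs)) (der c∈ ⌜ xs ⌝ˡ (Ders-cong (sym ∘ ⌜⌝ˡ-! xs) ds))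

  Closed : (ℕ → Set) → Set
  Closed P = All (λ c → ∀ θ → All (λ t → P (⟦ t ⟧ θ)) (premises c) → P (⟦ conclusion c ⟧ θ)) clauses

  module _ (P : ℕ → Set) (closed : Closed P) where
    mutual
      Der-elim : ∀ {a} → Der a → P a
      Der-elim (der c∈ e ds) = All.lookup closed c∈ (e !_) (Ders-elim ds)

      Ders-elim : ∀ {θ ts} → Ders θ ts → All (λ t → P (⟦ t ⟧ θ)) ts
      Ders-elim []       = []
      Ders-elim (d ∷ ds) = Der-elim d ∷ Ders-elim ds

  -- A certificate e consists of the derived goal e ! 0, the untouched stack e ! 1, and the
  -- instantiation of the variables.
  step : ℕ → ℕ → ℕ
  step e k = ifz (mismatch clauses (tl (tl e) !_) (e ! 0) (e ! 1) k) (e ! 0 ∙ e ! 1) k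

  stepᶜ : Comp f → Comp g → Comp (λ xs → step (f xs) (g xs))
  stepᶜ f g = ifzᶜ (mismatchᶜ clauses (tlᶜ (tlᶜ f)) (!ᶜ 0 f) (!ᶜ 1 f) g) (!ᶜ 0 f ∙ᶜ !ᶜ 1 f) g

  -- A state pairs a stack of derived goals with the remaining certificates.
  run : ℕ → ℕ → ℕ
  run zero    cert = 0 ∙ cert
  run (suc j) cert = step (hd (tl (run j cert))) (hd (run j cert)) ∙ tl (tl (run j cert))

  runᶜ : Comp f → Comp g → Comp (λ xs → run (f xs) (g xs))
  runᶜ = app₂ run (recᶜ (constᶜ 0 ∙ᶜ varᶜ zero)
    (stepᶜ (hdᶜ (tlᶜ (varᶜ (suc zero)))) (hdᶜ (varᶜ (suc zero))) ∙ᶜ tlᶜ (tlᶜ (varᶜ (suc zero))))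
    (λ _ → refl) (λ _ _ → refl))

  data Good : ℕ → Set where
    nil  : Good 0
    cons : ∀ {a k} → Der a → Good k → Good (a ∙ k)

  Good-uncons : ∀ {k l a} → Good k → k ≡ a ∙ l → Der a × Good l
  Good-uncons nil eq with () ← ∙≢0 (sym eq)
  Good-uncons (cons d gd) eq with refl , refl ← ∙-injective eq = d , gd

  Good-pop : ∀ {θ r} ts → Good (push θ ts r) → Ders θ ts × Good r
  Good-pop []       gd = [] , gd
  Good-pop (t ∷ ts) gd =
    let d , gd′ = Good-uncons gd refl ; ds , gd″ = Good-pop ts gd′ in d ∷ ds , gd″

  -- A certificate that fits no clause leaves the stack alone; one that fits pops derived premises
  -- and pushes their conclusion.
  step-sound : ∀ e {k} → Good k → Good (step e k)
  step-sound e {k} gd with mismatch clauses (tl (tl e) !_) (e ! 0) (e ! 1) k in eq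
  ... | suc _ = gd
  ... | zero with c , c∈ , p , q ← mismatch⁻ clauses eq
             with ds , gd′ ← Good-pop (premises c) (subst Good q gd) =
    cons (subst Der (sym p) (der c∈ _ ds)) gd′

  run-sound : ∀ j cert → Good (hd (run j cert))
  run-sound zero    cert = subst Good (sym (hd-∙ 0 cert)) nil
  run-sound (suc j) cert = subst Good (sym (hd-∙ _ _)) (step-sound _ (run-sound j cert))

  -- The leftover `cert` is arbitrary, so a run can be prolonged by demanding that the next
  -- certificate be its first entry.
  Reach : ℕ → Set
  Reach k = ∀ cert → ∃₂ λ j cert′ → run j cert′ ≡ k ∙ cert

  Reach-step : ∀ e {k} → Reach k → Reach (step e k)
  Reach-step e {k} reach cert with j , cert′ , eq ← reach (e ∙ cert) = suc j , cert′ , eq′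
    where
    eq′ : run (suc j) cert′ ≡ step e k ∙ cert
    eq′ rewrite eq | hd-∙ k (e ∙ cert) | tl-∙ k (e ∙ cert) | hd-∙ e cert | tl-∙ e cert = refl

  Reach-clause : ∀ {ts t r} → (ts ⊢ t) ∈ clauses → ∀ e →
                 Reach (push (e !_) ts r) → Reach (⟦ t ⟧ (e !_) ∙ r)
  Reach-clause {ts} {t} {r} c∈ e reach =
    subst Reach step-eq (Reach-step (⟦ t ⟧ (e !_) ∙ r ∙ e) reach)
    where
    step-eq : step (⟦ t ⟧ (e !_) ∙ r ∙ e) (push (e !_) ts r) ≡ ⟦ t ⟧ (e !_) ∙ r
    step-eq rewrite hd-∙ (⟦ t ⟧ (e !_)) (r ∙ e) | tl-∙ (⟦ t ⟧ (e !_)) (r ∙ e)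
                  | hd-∙ r e | tl-∙ r e
                  | mismatch⁺ {θ = e !_} {r = r} c∈ refl refl = refl

  mutual
    Reach-der : ∀ {a r} → Der a → Reach r → Reach (a ∙ r)
    Reach-der (der c∈ e ds) reach = Reach-clause c∈ e (Reach-ders ds reach)

    -- Premises are derived from last to first, since the first one has to end up on top.
    Reach-ders : ∀ {θ ts r} → Ders θ ts → Reach r → Reach (push θ ts r)
    Reach-ders []       reach = reach
    Reach-ders (d ∷ ds) reach = Reach-der d (Reach-ders ds reach)

  -- Certificates are read off a derivation, and conversely `Good` is an invariant of every run. As
  -- `run` is computable, derivability becomes a search.
  Der⇔run : ∀ a → Der a ⇔ ∃₂ λ j cert → hd (run j cert) ≡ a ∙ 0
  Der⇔run a = mk⇔
    -- The empty stack is reached in 0 steps; the last 0 is the leftover, chosen empty.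
    (λ d → let j , cert , eq = Reach-der d (λ cert → 0 , cert , refl) 0
           in j , cert , trans (cong hd eq) (hd-∙ (a ∙ 0) 0))
    (λ (j , cert , eq) → proj₁ (Good-uncons (run-sound j cert) eq))

-- Halting of codes as a set generated by Horn clauses

mutual
  -- Arities are not recorded, so one number may stand for several codes; soundness is therefore
  -- stated for all of them at once.
  ⌜_⌝ : Code n → ℕ
  ⌜ zer ⌝       = 0 ∙ 0
  ⌜ succ ⌝      = 1 ∙ 0
  ⌜ proj i ⌝    = 2 ∙ toℕ i
  ⌜ comp f gs ⌝ = 3 ∙ ⌜ f ⌝ ∙ ⌜ gs ⌝*
  ⌜ prec g h ⌝  = 4 ∙ ⌜ g ⌝ ∙ ⌜ h ⌝
  ⌜ mu f ⌝      = 5 ∙ ⌜ f ⌝ ∙ 0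

  ⌜_⌝* : Vec (Code n) m → ℕ
  ⌜ [] ⌝*     = 6 ∙ 0
  ⌜ g ∷ gs ⌝* = 7 ∙ ⌜ g ⌝ ∙ ⌜ gs ⌝*

⌜_⌝ᵛ : Vec ℕ n → ℕ
⌜ [] ⌝ᵛ     = 0
⌜ x ∷ xs ⌝ᵛ = x ∙ ⌜ xs ⌝ᵛ

goal : ℕ → ℕ → ℕ → ℕ
goal c x v = c ∙ x ∙ v

goalᵗ : Term → Term → Term → Term
goalᵗ c x v = c ⊙ x ⊙ v

-- The code 5 ∙ ⌜ f ⌝ ∙ y stands for the search for a zero of f starting at y.
clauses : List Clause
clauses
  = ([] ⊢ goalᵗ (lit 0 ⊙ lit 0) (var 0) (lit 0))
  ∷ ([] ⊢ goalᵗ (lit 1 ⊙ lit 0) (var 0 ⊙ lit 0) (s (var 0)))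
  ∷ ([] ⊢ goalᵗ (lit 2 ⊙ lit 0) (var 0 ⊙ var 1) (var 0))
  ∷ (goalᵗ (lit 2 ⊙ var 0) (var 2) (var 3) ∷ []
     ⊢ goalᵗ (lit 2 ⊙ s (var 0)) (var 1 ⊙ var 2) (var 3))
  ∷ (goalᵗ (var 1) (var 2) (var 4) ∷ goalᵗ (var 0) (var 4) (var 3) ∷ []
     ⊢ goalᵗ (lit 3 ⊙ var 0 ⊙ var 1) (var 2) (var 3))
  ∷ (goalᵗ (var 0) (var 2) (var 3) ∷ []
     ⊢ goalᵗ (lit 4 ⊙ var 0 ⊙ var 1) (lit 0 ⊙ var 2) (var 3))
  ∷ (goalᵗ (lit 4 ⊙ var 0 ⊙ var 1) (var 2 ⊙ var 3) (var 5)
     ∷ goalᵗ (var 1) (var 2 ⊙ var 5 ⊙ var 3) (var 4) ∷ []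
     ⊢ goalᵗ (lit 4 ⊙ var 0 ⊙ var 1) (s (var 2) ⊙ var 3) (var 4))
  ∷ (goalᵗ (var 0) (var 1 ⊙ var 2) (lit 0) ∷ []
     ⊢ goalᵗ (lit 5 ⊙ var 0 ⊙ var 1) (var 2) (var 1))
  ∷ (goalᵗ (var 0) (var 1 ⊙ var 2) (s (var 4))
     ∷ goalᵗ (lit 5 ⊙ var 0 ⊙ s (var 1)) (var 2) (var 3) ∷ []
     ⊢ goalᵗ (lit 5 ⊙ var 0 ⊙ var 1) (var 2) (var 3))
  ∷ ([] ⊢ goalᵗ (lit 6 ⊙ lit 0) (var 0) (lit 0))
  ∷ (goalᵗ (var 0) (var 2) (var 3) ∷ goalᵗ (var 1) (var 2) (var 4) ∷ []
     ⊢ goalᵗ (lit 7 ⊙ var 0 ⊙ var 1) (var 2) (var 3 ⊙ var 4))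
  ∷ []

open Generation clauses

mutual
  -- Each list supplies the values of `var 0`, `var 1` and so on in the selected clause.
  ⇓⇒Der : {c : Code n} → ∀ {xs v} → c [ xs ]⇓ v → Der (goal ⌜ c ⌝ ⌜ xs ⌝ᵛ v)
  ⇓⇒Der {xs = xs} zer = derˡ (here refl) (⌜ xs ⌝ᵛ ∷ []) []
  ⇓⇒Der (succ {x}) = derˡ (there (here refl)) (x ∷ []) []
  ⇓⇒Der (proj {i = i} {xs}) = proj⇒Der i xs
  ⇓⇒Der {xs = xs} {v} (comp {f = f} {gs} {vs = vs} ds d) =
    derˡ (there (there (there (there (here refl)))))
         (⌜ f ⌝ ∷ ⌜ gs ⌝* ∷ ⌜ xs ⌝ᵛ ∷ v ∷ ⌜ vs ⌝ᵛ ∷ []) (⇓*⇒Der ds ∷ ⇓⇒Der d ∷ [])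
  ⇓⇒Der {v = v} (precz {g = g} {h} {xs} d) =
    derˡ (there (there (there (there (there (here refl))))))
         (⌜ g ⌝ ∷ ⌜ h ⌝ ∷ ⌜ xs ⌝ᵛ ∷ v ∷ []) (⇓⇒Der d ∷ [])
  ⇓⇒Der {v = v} (precs {g = g} {h} {xs} {y} {r} d e) =
    derˡ (there (there (there (there (there (there (here refl)))))))
         (⌜ g ⌝ ∷ ⌜ h ⌝ ∷ y ∷ ⌜ xs ⌝ᵛ ∷ v ∷ r ∷ []) (⇓⇒Der d ∷ ⇓⇒Der e ∷ [])
  -- `⌜ mu f ⌝` is by choice the code of the search from 0.
  ⇓⇒Der (mu d) = Search⇒Der d

  -- Terms cannot express `lookup`, so the clauses peel off one argument per successor of the index.
  proj⇒Der : ∀ (i : Fin n) xs → Der (goal ⌜ proj i ⌝ ⌜ xs ⌝ᵛ (lookup xs i))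
  proj⇒Der zero (x ∷ xs) = derˡ (there (there (here refl))) (x ∷ ⌜ xs ⌝ᵛ ∷ []) []
  proj⇒Der (suc i) (x ∷ xs) =
    derˡ (there (there (there (here refl)))) (toℕ i ∷ x ∷ ⌜ xs ⌝ᵛ ∷ lookup xs i ∷ [])
         (proj⇒Der i xs ∷ [])

  ⇓*⇒Der : {gs : Vec (Code n) m} → ∀ {xs vs} → gs [ xs ]⇓* vs → Der (goal ⌜ gs ⌝* ⌜ xs ⌝ᵛ ⌜ vs ⌝ᵛ)
  ⇓*⇒Der {xs = xs} [] =
    derˡ (there (there (there (there (there (there (there (there (there (here refl))))))))))
         (⌜ xs ⌝ᵛ ∷ []) []
  ⇓*⇒Der (_∷_ {g = g} {gs} {xs} {v} {vs} d ds) =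
    derˡ (there (there (there (there (there (there (there (there (there (there (here refl)))))))))))
         (⌜ g ⌝ ∷ ⌜ gs ⌝* ∷ ⌜ xs ⌝ᵛ ∷ v ∷ ⌜ vs ⌝ᵛ ∷ []) (⇓⇒Der d ∷ ⇓*⇒Der ds ∷ [])

  Search⇒Der : {f : Code (suc n)} → ∀ {xs y v} → Search f xs y v →
               Der (goal (5 ∙ ⌜ f ⌝ ∙ y) ⌜ xs ⌝ᵛ v)
  Search⇒Der {f = f} {xs} {y} (stop d) =
    derˡ (there (there (there (there (there (there (there (here refl))))))))
         (⌜ f ⌝ ∷ y ∷ ⌜ xs ⌝ᵛ ∷ []) (⇓⇒Der d ∷ [])
  Search⇒Der {f = f} {xs} {y} {v} (next {w = w} d ds) =
    derˡ (there (there (there (there (there (there (there (there (here refl)))))))))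
         (⌜ f ⌝ ∷ y ∷ ⌜ xs ⌝ᵛ ∷ v ∷ w ∷ []) (⇓⇒Der d ∷ Search⇒Der ds ∷ [])

-- What a derived goal asserts, according to the tag of its code.
Meaning : (tag a x v : ℕ) → Set
Meaning 0 a x v = v ≡ 0
Meaning 1 a x v = ∀ {y} → x ≡ y ∙ 0 → v ≡ suc y
Meaning 2 a x v = ∀ {n} (i : Fin n) xs → a ≡ toℕ i → x ≡ ⌜ xs ⌝ᵛ → v ≡ lookup xs i
Meaning 3 a x v = ∀ {n m} (f : Code m) (gs : Vec (Code n) m) xs →
                  a ≡ ⌜ f ⌝ ∙ ⌜ gs ⌝* → x ≡ ⌜ xs ⌝ᵛ → comp f gs [ xs ]⇓ v
Meaning 4 a x v = ∀ {n} (g : Code n) h y xs →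
                  a ≡ ⌜ g ⌝ ∙ ⌜ h ⌝ → x ≡ y ∙ ⌜ xs ⌝ᵛ → prec g h [ y ∷ xs ]⇓ v
Meaning 5 a x v = ∀ {n} (f : Code (suc n)) y xs →
                  a ≡ ⌜ f ⌝ ∙ y → x ≡ ⌜ xs ⌝ᵛ → Search f xs y v
Meaning 6 a x v = v ≡ 0
Meaning 7 a x v = ∀ {n m} (g : Code n) (gs : Vec (Code n) m) xs →
                  a ≡ ⌜ g ⌝ ∙ ⌜ gs ⌝* → x ≡ ⌜ xs ⌝ᵛ → ∃ λ vs → v ≡ ⌜ vs ⌝ᵛ × (g ∷ gs) [ xs ]⇓* vs
Meaning _ a x v = ⊤

-- `Der-elim` needs a predicate of bare numbers, hence the equation; numbers that are not goals
-- satisfy it vacuously.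
Sound : ℕ → Set
Sound k = ∀ {tag a x v} → k ≡ goal (tag ∙ a) x v → Meaning tag a x v

sound : ∀ {tag a x v} → Meaning tag a x v → Sound (goal (tag ∙ a) x v)
sound meaning eq
  with eq₁ , eq₂ ← ∙-injective eq
  with refl , refl ← ∙-injective eq₁ | refl , refl ← ∙-injective eq₂ = meaning

-- A case split suffices: the tag of `⌜ c ⌝` selects the case of `Meaning` that determines the
-- evaluation.
Sound⇒⇓ : (c : Code n) → ∀ {xs v} → Sound (goal ⌜ c ⌝ ⌜ xs ⌝ᵛ v) → c [ xs ]⇓ v
Sound⇒⇓ zer S = subst (_ [ _ ]⇓_) (sym (S refl)) zer
Sound⇒⇓ succ {x ∷ []} S = subst (_ [ _ ]⇓_) (sym (S refl refl)) succ
Sound⇒⇓ (proj i) {xs} S = subst (_ [ _ ]⇓_) (sym (S refl i xs refl refl)) proj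
Sound⇒⇓ (comp f gs) {xs} S = S refl f gs xs refl refl
Sound⇒⇓ (prec g h) {y ∷ xs} S = S refl g h y xs refl refl
Sound⇒⇓ (mu f) {xs} S = mu (S refl f 0 xs refl refl)

Sound⇒⇓* : (gs : Vec (Code n) m) → ∀ {xs v} → Sound (goal ⌜ gs ⌝* ⌜ xs ⌝ᵛ v) →
           ∃ λ vs → v ≡ ⌜ vs ⌝ᵛ × gs [ xs ]⇓* vs
Sound⇒⇓* [] S = [] , S refl , []
Sound⇒⇓* (g ∷ gs) {xs} S = S refl g gs xs refl refl

clauses-sound : Closed Sound
clauses-sound
  = (λ θ _ → sound {0} refl)
  ∷ (λ θ _ → sound {1} λ eq → cong suc (proj₁ (∙-injective eq)))
  ∷ (λ θ _ → sound {2} proj-zero)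
  ∷ (λ { θ (S ∷ []) → sound {2} (proj-suc S) })
  ∷ (λ { θ (S ∷ T ∷ []) → sound {3} (comp-sound S T) })
  ∷ (λ { θ (S ∷ []) → sound {4} (prec-zero S) })
  ∷ (λ { θ (S ∷ T ∷ []) → sound {4} (prec-suc S T) })
  ∷ (λ { θ (S ∷ []) → sound {5} (search-stop S) })
  ∷ (λ { θ (S ∷ T ∷ []) → sound {5} (search-next S T) })
  ∷ (λ θ _ → sound {6} refl)
  ∷ (λ { θ (S ∷ T ∷ []) → sound {7} (cons-sound S T) })
  ∷ []
  where
  proj-zero : ∀ {x y} → Meaning 2 0 (x ∙ y) x
  proj-zero zero (z ∷ zs) _ eq = proj₁ (∙-injective eq)

  proj-suc : ∀ {a x y v} → Sound (goal (2 ∙ a) y v) → Meaning 2 (suc a) (x ∙ y) v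
  proj-suc S (suc i) (z ∷ zs) refl eq = S refl i zs refl (proj₂ (∙-injective eq))

  comp-sound : ∀ {a b x v w} → Sound (goal b x w) → Sound (goal a w v) → Meaning 3 (a ∙ b) x v
  comp-sound S T f gs xs eq refl with refl , refl ← ∙-injective eq
    -- A priori `w` is just a number; the premise on `gs` shows that it codes a vector, and then the
    -- premise on `f` applies.
    with vs , refl , ds ← Sound⇒⇓* gs {xs} S = comp ds (Sound⇒⇓ f {vs} T)

  prec-zero : ∀ {a b x v} → Sound (goal a x v) → Meaning 4 (a ∙ b) (0 ∙ x) v
  prec-zero S g h y xs eq eq′ with refl , refl ← ∙-injective eq | refl , refl ← ∙-injective eq′ =
    precz (Sound⇒⇓ g {xs} S)

  prec-suc : ∀ {a b y x v r} → Sound (goal (4 ∙ a ∙ b) (y ∙ x) r) → Sound (goal b (y ∙ r ∙ x) v) →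
             Meaning 4 (a ∙ b) (suc y ∙ x) v
  prec-suc {y = y} {r = r} S T g h _ xs eq eq′
    with refl , refl ← ∙-injective eq | refl , refl ← ∙-injective eq′ =
    precs (S refl g h y xs refl refl) (Sound⇒⇓ h {y ∷ r ∷ xs} T)

  search-stop : ∀ {a y x} → Sound (goal a (y ∙ x) 0) → Meaning 5 (a ∙ y) x y
  search-stop S f y xs eq refl with refl , refl ← ∙-injective eq = stop (Sound⇒⇓ f {y ∷ xs} S)

  search-next : ∀ {a y x v w} → Sound (goal a (y ∙ x) (suc w)) → Sound (goal (5 ∙ a ∙ suc y) x v) →
                Meaning 5 (a ∙ y) x v
  search-next S T f y xs eq refl with refl , refl ← ∙-injective eq =
    next (Sound⇒⇓ f {y ∷ xs} S) (T refl f (suc y) xs refl refl)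

  cons-sound : ∀ {a b x v w} → Sound (goal a x v) → Sound (goal b x w) → Meaning 7 (a ∙ b) x (v ∙ w)
  cons-sound {v = v} S T g gs xs eq refl with refl , refl ← ∙-injective eq
    with vs , refl , ds ← Sound⇒⇓* gs {xs} T = v ∷ vs , refl , Sound⇒⇓ g {xs} S ∷ ds

-- The clauses do not depend on `c`, so they act as a universal machine with program `⌜ c ⌝`.
Halts⇔Der : (c : Code n) → ∀ xs → Halts c xs ⇔ ∃ λ v → Der (goal ⌜ c ⌝ ⌜ xs ⌝ᵛ v)
Halts⇔Der c xs = mk⇔
  (λ (k , v , eq) → v , ⇓⇒Der (eval⇒⇓ k c eq))
  (λ (v , d) → let k , eq = ⇓⇒eval (Sound⇒⇓ c (Der-elim Sound clauses-sound d)) in k , v , eq)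

-- Light ceers

-- Universality of a quotient, applied to this ceer, makes the quotient light.
≡-isCeer : IsCeer _≡_
≡-isCeer = isEquivalence , IsCE₂-∃ (distᶜ (varᶜ (suc zero)) (varᶜ (suc (suc zero))))
  λ x y → mk⇔ (λ { refl → 0 , dist-refl x }) (λ (_ , eq) → dist≡0⇒≡ eq)

-- The quotient contains `E`, so images that it separates are separated by `E`.
Light-quotient⁻ : ∀ {E W} → IsEquivalence E → Light (Quot E W) → Light E
Light-quotient⁻ E-equiv (f , f-comp , f-red) = f , f-comp , λ x y → mk⇔
  (λ { refl → IsEquivalence.refl E-equiv })
  (λ fxEfy → f-red x y .from (EqC.return (inj₁ fxEfy)))

-- `x ∙ y ∙ 0` is the argument vector of a binary code. A number `c` that codes nothing could only
-- glue inside its own column.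
Glue : (ℕ → ℕ) → Rel ℕ 0ℓ
Glue f a b = ∃₂ λ c x → ∃₂ λ y v → Der (goal c (x ∙ y ∙ 0) v) × f (c ∙ x) ≡ a × f (c ∙ y) ≡ b

Glue-isCE : ∀ {f} → Comp₁ f → IsCE₂ (Glue f)
Glue-isCE {f} f-comp = IsCE₂-∃ D-comp λ a b → mk⇔ to′ from′
  where
  target : ℕ → ℕ
  target k = goal (k ! 2) (k ! 3 ∙ k ! 4 ∙ 0) (k ! 5) ∙ 0

  -- The entries of `k` are the run length, the certificates, `c`, `x`, `y` and `v`; the three
  -- distances test the run and the two endpoints.
  D : ℕ → ℕ → ℕ → ℕ
  D k a b = dist (hd (run (k ! 0) (k ! 1))) (target k)
          + (dist (f (k ! 2 ∙ k ! 3)) a + dist (f (k ! 2 ∙ k ! 4)) b)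

  D-comp : Comp₃ D
  D-comp = distᶜ (hdᶜ (runᶜ (k !ᶠ 0) (k !ᶠ 1)))
                 ((k !ᶠ 2 ∙ᶜ (k !ᶠ 3 ∙ᶜ k !ᶠ 4 ∙ᶜ constᶜ 0) ∙ᶜ k !ᶠ 5) ∙ᶜ constᶜ 0)
        +ᶜ (distᶜ (app₁ f f-comp (k !ᶠ 2 ∙ᶜ k !ᶠ 3)) (varᶜ (suc zero))
        +ᶜ distᶜ (app₁ f f-comp (k !ᶠ 2 ∙ᶜ k !ᶠ 4)) (varᶜ (suc (suc zero))))
    where
    k = varᶜ {3} zero
    infixl 8 _!ᶠ_
    _!ᶠ_ : Comp g → ∀ i → Comp (λ xs → g xs ! i)
    g !ᶠ i = !ᶜ i g

  to′ : ∀ {a b} → Glue f a b → ∃ λ k → D k a b ≡ 0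
  to′ (c , x , y , v , d , refl , refl)
    with j , cert , eq ← Der⇔run _ .to d = ⌜ l ⌝ˡ , D≡0
    where
    l = j ∷ cert ∷ c ∷ x ∷ y ∷ v ∷ []
    D≡0 : D ⌜ l ⌝ˡ (f (c ∙ x)) (f (c ∙ y)) ≡ 0
    D≡0 rewrite ⌜⌝ˡ-! l 0 | ⌜⌝ˡ-! l 1 | ⌜⌝ˡ-! l 2 | ⌜⌝ˡ-! l 3 | ⌜⌝ˡ-! l 4 | ⌜⌝ˡ-! l 5 | eq
              | dist-refl (goal c (x ∙ y ∙ 0) v ∙ 0)
              | dist-refl (f (c ∙ x)) | dist-refl (f (c ∙ y)) = refl

  from′ : ∀ {a b} → (∃ λ k → D k a b ≡ 0) → Glue f a b
  from′ (k , D≡0) =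
    let run≡ , p = m+n≡0⇒m≡0 _ D≡0 , m+n≡0⇒n≡0 (dist (hd (run (k ! 0) (k ! 1))) (target k)) D≡0
        fcx≡a , fcy≡b = dist+dist≡0⇒≡×≡ p
    in k ! 2 , k ! 3 , k ! 4 , k ! 5 ,
       Der⇔run _ .from (k ! 0 , k ! 1 , dist≡0⇒≡ run≡) , fcx≡a , fcy≡b

module _ {E : Rel ℕ 0ℓ} (E-equiv : IsEquivalence E)
         {f : ℕ → ℕ} (f-comp : Comp₁ f) (f-red : ∀ x y → x ≡ y ⇔ E (f x) (f y)) where

  open IsEquivalence E-equiv renaming (refl to E-refl; sym to E-sym; trans to E-trans)

  Glue-halting : (c : Code 2) → ∀ {x y} → Halts c (x ∷ y ∷ []) →
                 Glue f (f (⌜ c ⌝ ∙ x)) (f (⌜ c ⌝ ∙ y))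
  Glue-halting c halts with v , d ← Halts⇔Der c _ .to halts = ⌜ c ⌝ , _ , _ , v , d , refl , refl

  Quot-Glue-universal : Universal (Quot E (Glue f))
  Quot-Glue-universal A (A-equiv , c , A⇔) = column ,
    Comp₁⇒Computable (app₁ f f-comp (constᶜ ⌜ c ⌝ ∙ᶜ varᶜ zero)) ,
    λ x y → mk⇔ (λ Axy → EqC.return (inj₂ (Glue-halting c (A⇔ x y .to Axy))))
                (λ chain → let z , Axz , eq = track chain A-refl E-refl
                           -- The chain ends at `column y`, which is `E`-equivalent to `column z`;
                           -- hence `z` is `y`.
                           in subst (A x) (proj₂ (∙-injective (f-red _ _ .from (E-sym eq)))) Axz)
    where
    open IsEquivalence A-equiv renaming (refl to A-refl; sym to A-sym; trans to A-trans)
    column : ℕ → ℕ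
    column x = f (⌜ c ⌝ ∙ x)

    Der⇒A : ∀ {x y v} → Der (goal ⌜ c ⌝ (x ∙ y ∙ 0) v) → A x y
    Der⇒A d = A⇔ _ _ .from (Halts⇔Der c _ .from (_ , d))

    -- At a glueing link, `f-red` and injectivity of pairing force the link into column `⌜ c ⌝` with
    -- its near end at `y`, so the link is an instance of `A`.
    track : ∀ {x y a b} → EqClosure (E ∪ Glue f) a b → A x y → E (column y) a →
            ∃ λ z → A x z × E b (column z)
    track ε Axy eq = _ , Axy , E-sym eq
    track (fwd (inj₁ e) ◅ chain) Axy eq = track chain Axy (E-trans eq e)
    track (bwd (inj₁ e) ◅ chain) Axy eq = track chain Axy (E-trans eq (E-sym e))
    track (fwd (inj₂ (_ , _ , _ , _ , d , refl , refl)) ◅ chain) Axy eq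
      with refl , refl ← ∙-injective (f-red _ _ .from eq) =
      track chain (A-trans Axy (Der⇒A d)) E-refl
    track (bwd (inj₂ (_ , _ , _ , _ , d , refl , refl)) ◅ chain) Axy eq
      with refl , refl ← ∙-injective (f-red _ _ .from eq) =
      track chain (A-trans Axy (A-sym (Der⇒A d))) E-refl

  Quot-Glue-nontrivial : Quot E (Glue f) ≠R E
  Quot-Glue-nontrivial Quot⇔E
    -- The binary code `zer` halts on 0 and 1 with fuel 1, so places 0 and 1 of its column are
    -- glued; `E` would make 0 equal to 1.
    with () ← proj₂ (∙-injective (f-red _ _ .from (Quot⇔E _ _ .to
                (EqC.return (inj₂ (Glue-halting zer {0} {1} (1 , 0 , refl)))))))

theorem4p8 : (E : Rel ℕ 0ℓ) → IsCeer E →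
    Light E ⇔ Σ (Rel ℕ 0ℓ) (λ W → IsCE₂ W × (Quot E W ≠R E) × Universal (Quot E W))
theorem4p8 E (E-equiv , _) = mk⇔
  (λ (f , f-computable , f-red) →
    let f-comp = Computable⇒Comp₁ {f} f-computable in
    Glue f , Glue-isCE {f} f-comp , Quot-Glue-nontrivial E-equiv {f} f-comp f-red
           , Quot-Glue-universal E-equiv {f} f-comp f-red)
  (λ (W , _ , _ , universal) → Light-quotient⁻ E-equiv (universal _≡_ ≡-isCeer))
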